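{- Let $H$ be a graph with $v$ vertices which is bicycle-free at radius $r$, and assume $r \geq 10 \ln v$. Then $\mathrm{exc}(H) \leq \frac{\ln(ev)}{r} v$.
   Context: The excess of a multigraph $H=(V,E)$ is $\mathrm{exc}(H) = |E| - |V|$. A connected multigraph with excess $-1$ or $0$ is called bicycle-free. A multigraph is bicycle-free at radius $r$ if the distance-$r$ neighborhood of every vertex is bicycle-free. -}

module Defs where

open import Data.Nat using (ℕ; zero; suc; _+_; _*_; _≤_; _^_; _!)
open import Data.Bool using (Bool; true; false; _∨_; _∧_)
open import Data.Fin using (Fin)
open import Data.Fin.Properties using (_≟_)
open import Data.List using (List; []; _∷_; length; filterᵇ; allFin)
open import Data.Product using (_×_; _,_; Σ; ∃-syntax)
open import Data.Integer using (ℤ)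
import Data.Integer as ℤ
open import Relation.Nullary.Decidable using (⌊_⌋)

-- Finite multigraphs (loops and multiple edges allowed).
-- Vertex set Fin v; the edge multiset is a list of unordered pairs,
-- each edge (a , b) being read as the undirected edge {a , b}.

record MultiGraph : Set where
  constructor mkGraph
  field
    nV    : ℕ
    edges : List (Fin nV × Fin nV)
open MultiGraph public

exc : MultiGraph → ℤ
exc H = ℤ.+ length (edges H) ℤ.- ℤ.+ nV H

private
  anyE : {n : ℕ} → (Fin n × Fin n → Bool) → List (Fin n × Fin n) → Bool
  anyE p []       = false
  anyE p (e ∷ es) = p e ∨ anyE p es

inBall : (H : MultiGraph) → Fin (nV H) → ℕ → Fin (nV H) → Bool
inBall H x zero    y = ⌊ x ≟ y ⌋
inBall H x (suc r) y =
  inBall H x r y ∨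
  anyE (λ { (a , b) → (inBall H x r a ∧ ⌊ b ≟ y ⌋) ∨ (inBall H x r b ∧ ⌊ a ≟ y ⌋) })
       (edges H)

ballVertices : (H : MultiGraph) → Fin (nV H) → ℕ → ℕ
ballVertices H x r = length (filterᵇ (inBall H x r) (allFin (nV H)))

ballEdges : (H : MultiGraph) → Fin (nV H) → ℕ → ℕ
ballEdges H x r =
  length (filterᵇ (λ { (a , b) → inBall H x r a ∧ inBall H x r b }) (edges H))

-- (H , x)_r is connected by construction, so it is bicycle-free iff its
-- excess is ≤ 0 (excess ≥ -1 holds automatically for connected graphs).
BicycleFreeAtRadius : MultiGraph → ℕ → Set
BicycleFreeAtRadius H r = (x : Fin (nV H)) → ballEdges H x r ≤ ballVertices H x r

-- Exponential comparisons, used to express inequalities involving ln.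
-- expPartial m n = n! · Σ_{k=0}^{n} m^k / k!   (a natural number), so
-- the n-th Taylor partial sum of e^m is  expPartial m n / n!.

expPartial : ℕ → ℕ → ℕ
expPartial m zero    = 1
expPartial m (suc n) = suc n * expPartial m n + m ^ suc n

-- e^m ≤ c   (the partial sums increase to e^m)
ExpLe : ℕ → ℕ → Set
ExpLe m c = (n : ℕ) → expPartial m n ≤ c * (n !)

-- c ≤ e^m   (for every ε = 1/(k+1) some partial sum exceeds c - ε)
ExpGe : ℕ → ℕ → Set
ExpGe m c = (k : ℕ) → ∃[ n ] (c * (n !) * suc k ≤ expPartial m n * suc k + n !)

{-# OPTIONS --safe #-}

-- Let x = exc(H) > 0 and let S be a smallest nonempty vertex set whose edge density is at least that of H.
-- By minimality every U ⊆ S is touched by at least (1 + x/v)|U| edges of H[S]. A ball of radius k ≤ r in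
-- H[S] contains at most as many edges as vertices, and all edges touching a ball lie in the next one, so
-- ball sizes grow by the factor 1 + x/v; with v¹⁰ ≤ eʳ this already gives 3x ≤ v. The factor is improved
-- to (2v + x)/(2v − x) ≥ e^(x/v): applying minimality to the ball together with the vertices of degree
-- two in the next layer gains when there are many of these, and otherwise the layer after that is larger
-- because the remaining vertices have degree at least three. Hence e^((r − 3)x/v) ≤ v, and
-- xr − v ≤ (r − 3)x.
module Submission where

open import Defs
open import Data.Bool using (Bool; true; false; _∨_; _∧_; not)
open import Data.Bool.ListAction using (any)
open import Data.Bool.Properties using (T-≡; ∨-zeroʳ) renaming (_≟_ to _≟ᵇ_)
open import Data.Fin using (Fin; zero; suc)
open import Data.Fin.Properties using (any?) renaming (_≟_ to _≟ᶠ_)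
open import Data.Fin.Subset using (Subset)
open import Data.Fin.Subset.Properties using (anySubset?)
import Data.Integer as ℤ
import Data.Integer.Properties as ℤ
open import Data.List using (List; []; _∷_; length; filterᵇ; allFin; map)
open import Data.List.Membership.Propositional using (_∈_)
open import Data.List.Membership.Propositional.Properties using (∈-filter⁻; ∈-allFin)
open import Data.List.Properties using (map-tabulate; length-tabulate)
open import Data.List.Relation.Unary.Any using (here; there)
open import Data.Nat
open import Data.Nat.Properties
open import Data.Nat.Tactic.RingSolver using (solve-∀)
open import Data.Product using (_×_; _,_; proj₁; proj₂; ∃-syntax)
open import Data.Sum using (_⊎_; inj₁; inj₂)
open import Data.Vec using (lookup) renaming (tabulate to tabulateᵛ)
open import Data.Vec.Properties using (lookup∘tabulate)
open import Function using (_∘_; id; Equivalence)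
open import Relation.Binary.PropositionalEquality using (_≡_; refl; sym; trans; cong; cong₂; subst; subst₂)
open import Relation.Nullary using (¬_; Dec; yes; no; contradiction)
open import Relation.Nullary.Decidable using (⌊_⌋; map′; toWitness; _→-dec_; _×-dec_; T?)

open ≤-Reasoning

-- Taylor sums of the exponential

-- With A = B + x this is (A - B)(A^k - B^k) ≥ 0, multiplied out to avoid subtraction.
chebyshev : ∀ B x k → (B + x) * B ^ k + B * (B + x) ^ k ≤ (B + x) ^ suc k + B ^ suc k
chebyshev B x k = begin
  (B + x) * B ^ k + B * (B + x) ^ k               ≡⟨ lhs B x (B ^ k) ((B + x) ^ k) ⟩
  (B * B ^ k + B * (B + x) ^ k) + x * B ^ k       ≤⟨ +-monoʳ-≤ _ (*-monoʳ-≤ x (^-monoˡ-≤ k (m≤m+n B x))) ⟩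
  (B * B ^ k + B * (B + x) ^ k) + x * (B + x) ^ k ≡⟨ rhs B x (B ^ k) ((B + x) ^ k) ⟩
  (B + x) ^ suc k + B ^ suc k                     ∎
  where
  lhs : ∀ B x p q → (B + x) * p + B * q ≡ (B * p + B * q) + x * p
  lhs = solve-∀
  rhs : ∀ B x p q → (B * p + B * q) + x * q ≡ (B + x) * q + B * p
  rhs = solve-∀

-- The trapezoid rule on [B, B + x] overestimates the integral of the convex function (k + 1) t^k.
-- The induction writes 2(B + x) as (2B + x) + x and removes the mixed products by `chebyshev`.
trapezoid : ∀ B x k → 2 * (B + x) ^ suc k ≤ 2 * B ^ suc k + suc k * x * ((B + x) ^ k + B ^ k)
trapezoid B x zero    = ≤-reflexive (base B x)
  where
  base : ∀ B x → 2 * ((B + x) * 1) ≡ 2 * (B * 1) + 1 * x * (1 + 1)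
  base = solve-∀
trapezoid B x (suc k) = *-cancelˡ-≤ 2 (begin
  2 * (2 * (A * A′))
    ≡⟨ e₁ B x A′ ⟩
  (A + B) * (2 * A′) + 2 * x * A′
    ≤⟨ +-monoˡ-≤ _ (*-monoʳ-≤ (A + B) (trapezoid B x k)) ⟩
  (A + B) * (2 * B′ + suc k * x * (A ^ k + B ^ k)) + 2 * x * A′
    ≡⟨ e₂ B x (suc k) (A ^ k) (B ^ k) ⟩
  suc k * x * (A * B ^ k + B * A ^ k) + (suc k * x * (A′ + B′) + (A + B) * (2 * B′) + 2 * x * A′)
    ≤⟨ +-monoˡ-≤ _ (*-monoʳ-≤ (suc k * x) (chebyshev B x k)) ⟩
  suc k * x * (A′ + B′) + (suc k * x * (A′ + B′) + (A + B) * (2 * B′) + 2 * x * A′)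
    ≡⟨ e₃ B x (suc k) A′ B′ ⟩
  2 * (2 * (B * B′) + suc (suc k) * x * (A′ + B′)) ∎)
  where
  A = B + x
  A′ = A ^ suc k
  B′ = B ^ suc k
  e₁ : ∀ B x q → 2 * (2 * ((B + x) * q)) ≡ ((B + x) + B) * (2 * q) + 2 * x * q
  e₁ = solve-∀
  e₂ : ∀ B x K p q → ((B + x) + B) * (2 * (B * q) + K * x * (p + q)) + 2 * x * ((B + x) * p)
     ≡ K * x * ((B + x) * q + B * p) + (K * x * ((B + x) * p + B * q) + ((B + x) + B) * (2 * (B * q)) + 2 * x * ((B + x) * p))
  e₂ = solve-∀
  e₃ : ∀ B x K p q → K * x * (p + q) + (K * x * (p + q) + ((B + x) + B) * (2 * q) + 2 * x * p)
     ≡ 2 * (2 * (B * q) + (1 + K) * x * (p + q))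
  e₃ = solve-∀

^-distribʳ-* : ∀ k a b → (a * b) ^ k ≡ a ^ k * b ^ k
^-distribʳ-* zero    a b = refl
^-distribʳ-* (suc k) a b = trans (cong (a * b *_) (^-distribʳ-* k a b)) (e a b (a ^ k) (b ^ k))
  where
  e : ∀ a b p q → a * b * (p * q) ≡ a * p * (b * q)
  e = solve-∀

-- n! Dⁿ times the n-th Taylor partial sum of e^(a/D)
scaledExp : ℕ → ℕ → ℕ → ℕ
scaledExp D a zero    = 1
scaledExp D a (suc n) = suc n * D * scaledExp D a n + a ^ suc n

scaledExp-zero : ∀ D n → scaledExp D 0 n ≡ n ! * D ^ n
scaledExp-zero D zero    = refl
scaledExp-zero D (suc n) = trans (cong (λ q → suc n * D * q + 0) (scaledExp-zero D n)) (e (suc n) D (n !) (D ^ n))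
  where
  e : ∀ N D f p → N * D * (f * p) + 0 ≡ N * f * (D * p)
  e = solve-∀

scaledExp-integer : ∀ D m n → scaledExp D (D * m) n ≡ D ^ n * expPartial m n
scaledExp-integer D m zero    = refl
scaledExp-integer D m (suc n) = trans
  (cong₂ (λ p q → suc n * D * p + q) (scaledExp-integer D m n) (^-distribʳ-* (suc n) D m))
  (e (suc n) D (D ^ n) (expPartial m n) (m ^ suc n))
  where
  e : ∀ N D p q s → N * D * (p * q) + D * p * s ≡ D * p * (N * q + s)
  e = solve-∀

-- `trapezoid` applied term by term: the derivative of `scaledExp D a (suc n)` in `a` is
-- `suc n * scaledExp D a n`.
scaledExp-increment : ∀ D B x n →
  2 * scaledExp D (B + x) (suc n) ≤
  2 * scaledExp D B (suc n) + suc n * x * (scaledExp D (B + x) n + scaledExp D B n)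
scaledExp-increment D B x zero    = ≤-reflexive (e D B x)
  where
  e : ∀ D B x → 2 * (1 * D * 1 + (B + x) * 1) ≡ 2 * (1 * D * 1 + B * 1) + 1 * x * (1 + 1)
  e = solve-∀
scaledExp-increment D B x (suc n) = begin
  2 * (N * D * QA + A ^ N)
    ≡⟨ e₁ N D QA (A ^ N) ⟩
  N * D * (2 * QA) + 2 * A ^ N
    ≤⟨ +-mono-≤ (*-monoʳ-≤ (N * D) (scaledExp-increment D B x n)) (trapezoid B x (suc n)) ⟩
  N * D * (2 * QB + suc n * x * (scaledExp D A n + scaledExp D B n)) + (2 * B ^ N + N * x * (A ^ suc n + B ^ suc n))
    ≡⟨ e₂ N (suc n) D x QB (scaledExp D A n) (scaledExp D B n) (B ^ N) (A ^ suc n) (B ^ suc n) ⟩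
  2 * (N * D * QB + B ^ N) + N * x * (QA + QB) ∎
  where
  A = B + x
  N = suc (suc n)
  QA = scaledExp D A (suc n)
  QB = scaledExp D B (suc n)
  e₁ : ∀ N D q p → 2 * (N * D * q + p) ≡ N * D * (2 * q) + 2 * p
  e₁ = solve-∀
  e₂ : ∀ N M D x Q a b p s t → N * D * (2 * Q + M * x * (a + b)) + (2 * p + N * x * (s + t))
     ≡ 2 * (N * D * Q + p) + N * x * ((M * D * a + s) + (M * D * b + t))
  e₂ = solve-∀

-- e^(x/D) ≤ (2D + x)/(2D − x), with β = 2D − x
scaledExp-step : ∀ D B x β → 2 * D ≡ β + x → ∀ n →
  β * scaledExp D (B + x) n ≤ (β + 2 * x) * scaledExp D B n
scaledExp-step D B x β eq zero    = *-monoˡ-≤ 1 (m≤m+n β (2 * x))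
scaledExp-step D B x β eq (suc n) = +-cancelʳ-≤ (x * QA) _ _ (begin
  β * QA + x * QA
    ≡⟨ trans (sym (*-distribʳ-+ QA β x)) (cong (_* QA) (sym eq)) ⟩
  2 * D * QA
    ≡⟨ e₁ D QA ⟩
  D * (2 * QA)
    ≤⟨ *-monoʳ-≤ D (scaledExp-increment D B x n) ⟩
  D * (2 * QB + suc n * x * (qA + qB))
    ≡⟨ e₂ D x (suc n) QB qA qB ⟩
  2 * D * QB + x * (suc n * D * qA + suc n * D * qB)
    -- Each lower sum, rescaled by `suc n * D`, is at most the next Taylor sum. This leaves an
    -- inequality in `QA` and `QB` alone, in which `x * QA` can be moved to the left.
    ≤⟨ +-monoʳ-≤ _ (*-monoʳ-≤ x (+-mono-≤ (m≤m+n (suc n * D * qA) ((B + x) ^ suc n)) (m≤m+n (suc n * D * qB) (B ^ suc n)))) ⟩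
  2 * D * QB + x * (QA + QB)
    ≡⟨ cong (λ q → q * QB + x * (QA + QB)) eq ⟩
  (β + x) * QB + x * (QA + QB)
    ≡⟨ e₃ β x QA QB ⟩
  (β + 2 * x) * QB + x * QA ∎)
  where
  QA = scaledExp D (B + x) (suc n)
  QB = scaledExp D B (suc n)
  qA = scaledExp D (B + x) n
  qB = scaledExp D B n
  e₁ : ∀ D q → 2 * D * q ≡ D * (2 * q)
  e₁ = solve-∀
  e₂ : ∀ D x N Q a b → D * (2 * Q + N * x * (a + b)) ≡ 2 * D * Q + x * (N * D * a + N * D * b)
  e₂ = solve-∀
  e₃ : ∀ β x a b → (β + x) * b + x * (a + b) ≡ (β + 2 * x) * b + x * a
  e₃ = solve-∀

scaledExp-power : ∀ D x β → 2 * D ≡ β + x → ∀ n i →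
  β ^ i * scaledExp D (i * x) n ≤ (β + 2 * x) ^ i * (n ! * D ^ n)
scaledExp-power D x β eq n zero    = ≤-reflexive (cong (1 *_) (scaledExp-zero D n))
scaledExp-power D x β eq n (suc i) = begin
  β * β ^ i * scaledExp D (x + i * x) n
    ≡⟨ cong (λ a → β * β ^ i * scaledExp D a n) (+-comm x (i * x)) ⟩
  β * β ^ i * scaledExp D (i * x + x) n
    ≡⟨ e β (β ^ i) _ ⟩
  β ^ i * (β * scaledExp D (i * x + x) n)
    ≤⟨ *-monoʳ-≤ (β ^ i) (scaledExp-step D (i * x) x β eq n) ⟩
  β ^ i * (α * scaledExp D (i * x) n)
    ≡⟨ e′ α (β ^ i) _ ⟩
  α * (β ^ i * scaledExp D (i * x) n)
    ≤⟨ *-monoʳ-≤ α (scaledExp-power D x β eq n i) ⟩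
  α * (α ^ i * (n ! * D ^ n))
    ≡⟨ sym (*-assoc α (α ^ i) _) ⟩
  α * α ^ i * (n ! * D ^ n) ∎
  where
  α = β + 2 * x
  e : ∀ a b c → a * b * c ≡ b * (a * c)
  e = solve-∀
  e′ : ∀ a b c → b * (a * c) ≡ a * (b * c)
  e′ = solve-∀

-- The bound (2D + x)/(2D - x) on e^(x/D) at D = x = 1 reads e ≤ 3.
expPartial≤3^ : ∀ m n → expPartial m n ≤ 3 ^ m * n !
expPartial≤3^ m n = begin
  expPartial m n                      ≡⟨ trans (sym (*-identityˡ _)) (cong (_* expPartial m n) (sym (^-zeroˡ n))) ⟩
  1 ^ n * expPartial m n              ≡⟨ sym (scaledExp-integer 1 m n) ⟩
  scaledExp 1 (1 * m) n               ≡⟨ cong (λ a → scaledExp 1 a n) (*-comm 1 m) ⟩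
  scaledExp 1 (m * 1) n               ≡⟨ sym (trans (cong (_* scaledExp 1 (m * 1) n) (^-zeroˡ m)) (*-identityˡ _)) ⟩
  1 ^ m * scaledExp 1 (m * 1) n       ≤⟨ scaledExp-power 1 1 1 refl n m ⟩
  3 ^ m * (n ! * 1 ^ n)               ≡⟨ cong (3 ^ m *_) (trans (cong (n ! *_) (^-zeroˡ n)) (*-identityʳ _)) ⟩
  3 ^ m * n !                         ∎

-- An error of ε = 1/2 is small enough, because both sides are integers: 2c ≤ 2 · 3^r + 1 forces c ≤
-- 3^r.
ExpGe⇒≤3^ : ∀ {r c} → ExpGe r c → c ≤ 3 ^ r
ExpGe⇒≤3^ {r} {c} ge with n , h ← ge 1 = s≤s⁻¹ (*-cancelʳ-< 2 c (suc (3 ^ r)) (begin-strict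
  c * 2               ≤⟨ *-cancelʳ-≤ (c * 2) (3 ^ r * 2 + 1) (n !) {{n !≢0}} (begin
    c * 2 * n !                  ≡⟨ e c (n !) ⟩
    c * n ! * 2                  ≤⟨ h ⟩
    expPartial r n * 2 + n !     ≤⟨ +-monoˡ-≤ (n !) (*-monoˡ-≤ 2 (expPartial≤3^ r n)) ⟩
    3 ^ r * n ! * 2 + n !        ≡⟨ e′ (3 ^ r) (n !) ⟩
    (3 ^ r * 2 + 1) * n !        ∎) ⟩
  3 ^ r * 2 + 1       <⟨ ≤-reflexive (e″ (3 ^ r)) ⟩
  suc (3 ^ r) * 2     ∎))
  where
  e : ∀ c f → c * 2 * f ≡ c * f * 2
  e = solve-∀
  e′ : ∀ t f → t * f * 2 + f ≡ (t * 2 + 1) * f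
  e′ = solve-∀
  e″ : ∀ t → 1 + (t * 2 + 1) ≡ (1 + t) * 2
  e″ = solve-∀

expPartial-mono : ∀ {m m′} n → m ≤ m′ → expPartial m n ≤ expPartial m′ n
expPartial-mono zero    m≤m′ = ≤-refl
expPartial-mono (suc n) m≤m′ = +-mono-≤ (*-monoʳ-≤ (suc n) (expPartial-mono n m≤m′)) (^-monoˡ-≤ (suc n) m≤m′)

-- From ((2v + x)/(2v − x))^j ≤ v: raise to the power v and compare with (e^(x/v))^(vj).
ExpLe-from-growth : ∀ v x β j .{{_ : NonZero v}} .{{_ : NonZero β}} → 2 * v ≡ β + x →
  (β + 2 * x) ^ j ≤ β ^ j * v → ExpLe (j * x) (v ^ v)
ExpLe-from-growth v x β j eq h n =
  *-cancelˡ-≤ (β ^ (v * j) * v ^ n) {{m*n≢0 _ _ {{m^n≢0 β (v * j)}} {{m^n≢0 v n}}}} (begin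
    β ^ (v * j) * v ^ n * expPartial (j * x) n
      ≡⟨ *-assoc (β ^ (v * j)) (v ^ n) _ ⟩
    β ^ (v * j) * (v ^ n * expPartial (j * x) n)
      ≡⟨ cong (β ^ (v * j) *_) (sym (scaledExp-integer v (j * x) n)) ⟩
    β ^ (v * j) * scaledExp v (v * (j * x)) n
      ≡⟨ cong (λ a → β ^ (v * j) * scaledExp v a n) (sym (*-assoc v j x)) ⟩
    β ^ (v * j) * scaledExp v (v * j * x) n
      ≤⟨ scaledExp-power v x β eq n (v * j) ⟩
    α ^ (v * j) * (n ! * v ^ n)
      ≡⟨ cong (_* (n ! * v ^ n)) (flip-^ α) ⟩
    (α ^ j) ^ v * (n ! * v ^ n)
      ≤⟨ *-monoˡ-≤ (n ! * v ^ n) (^-monoˡ-≤ v h) ⟩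
    (β ^ j * v) ^ v * (n ! * v ^ n)
      ≡⟨ cong (_* (n ! * v ^ n)) (trans (^-distribʳ-* v (β ^ j) v) (cong (_* v ^ v) (sym (flip-^ β)))) ⟩
    β ^ (v * j) * v ^ v * (n ! * v ^ n)
      ≡⟨ e (β ^ (v * j)) (v ^ v) (n !) (v ^ n) ⟩
    β ^ (v * j) * v ^ n * (v ^ v * n !) ∎)
  where
  α = β + 2 * x
  flip-^ : ∀ a → a ^ (v * j) ≡ (a ^ j) ^ v
  flip-^ a = trans (cong (a ^_) (*-comm v j)) (sym (^-*-assoc a j v))
  e : ∀ a b c d → a * b * (c * d) ≡ a * d * (b * c)
  e = solve-∀

-- Growth of ball sizes, numerically

power-growth : ∀ (b : ℕ → ℕ) E v r → 1 ≤ b 0 → (∀ {k} → k < r → E * b k ≤ v * b (suc k)) →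
  ∀ k → k ≤ r → E ^ k ≤ v ^ k * b k
power-growth b E v r 1≤b₀ step zero    _   = ≤-trans 1≤b₀ (≤-reflexive (sym (*-identityˡ (b 0))))
power-growth b E v r 1≤b₀ step (suc k) k<r = begin
  E * E ^ k                 ≤⟨ *-monoʳ-≤ E (power-growth b E v r 1≤b₀ step k (<⇒≤ k<r)) ⟩
  E * (v ^ k * b k)         ≡⟨ e E (v ^ k) (b k) ⟩
  v ^ k * (E * b k)         ≤⟨ *-monoʳ-≤ (v ^ k) (step k<r) ⟩
  v ^ k * (v * b (suc k))   ≡⟨ e′ v (v ^ k) (b (suc k)) ⟩
  v * v ^ k * b (suc k)     ∎
  where
  e : ∀ a b c → a * (b * c) ≡ b * (a * c)
  e = solve-∀
  e′ : ∀ a b c → b * (a * c) ≡ a * b * c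
  e′ = solve-∀

-- If 3x > v then (4/3)^r ≤ v, whence 4^(10r) ≤ 3^(11r), against 3¹¹ < 4¹⁰.
3*excess≤order : ∀ v x r .{{_ : NonZero v}} .{{_ : NonZero r}} →
  (v + x) ^ r ≤ v ^ r * v → v ^ 10 ≤ 3 ^ r → 3 * x ≤ v
3*excess≤order v x r growth v¹⁰≤3^r = ≮⇒≥ λ v<3x → <-irrefl refl (begin-strict
  (3 ^ 11) ^ r              <⟨ ^-monoˡ-< r (≤ᵇ⇒≤ (suc (3 ^ 11)) (4 ^ 10) _) ⟩
  (4 ^ 10) ^ r              ≡⟨ swap-^ 4 10 ⟩
  (4 ^ r) ^ 10              ≤⟨ ^-monoˡ-≤ 10 (4^r≤ (<⇒≤ v<3x)) ⟩
  (3 ^ r * v) ^ 10          ≡⟨ ^-distribʳ-* 10 (3 ^ r) v ⟩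
  (3 ^ r) ^ 10 * v ^ 10     ≤⟨ *-monoʳ-≤ ((3 ^ r) ^ 10) v¹⁰≤3^r ⟩
  (3 ^ r) ^ 10 * 3 ^ r      ≡⟨ *-comm ((3 ^ r) ^ 10) (3 ^ r) ⟩
  (3 ^ r) ^ 11              ≡⟨ sym (swap-^ 3 11) ⟩
  (3 ^ 11) ^ r              ∎)
  where
  swap-^ : ∀ a k → (a ^ k) ^ r ≡ (a ^ r) ^ k
  swap-^ a k = trans (^-*-assoc a k r) (trans (cong (a ^_) (*-comm k r)) (sym (^-*-assoc a r k)))
  e : ∀ v → 4 * v ≡ 3 * v + v
  e = solve-∀
  e′ : ∀ a b c → a * (b * c) ≡ b * (a * c)
  e′ = solve-∀
  4^r≤ : v ≤ 3 * x → 4 ^ r ≤ 3 ^ r * v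
  4^r≤ v≤3x = *-cancelˡ-≤ (v ^ r) {{m^n≢0 v r}} (begin
    v ^ r * 4 ^ r           ≡⟨ trans (*-comm (v ^ r) (4 ^ r)) (sym (^-distribʳ-* r 4 v)) ⟩
    (4 * v) ^ r             ≡⟨ cong (_^ r) (e v) ⟩
    (3 * v + v) ^ r         ≤⟨ ^-monoˡ-≤ r (+-monoʳ-≤ (3 * v) v≤3x) ⟩
    (3 * v + 3 * x) ^ r     ≡⟨ cong (_^ r) (sym (*-distribˡ-+ 3 v x)) ⟩
    (3 * (v + x)) ^ r       ≡⟨ ^-distribʳ-* r 3 (v + x) ⟩
    3 ^ r * (v + x) ^ r     ≤⟨ *-monoʳ-≤ (3 ^ r) growth ⟩
    3 ^ r * (v ^ r * v)     ≡⟨ e′ (3 ^ r) (v ^ r) v ⟩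
    v ^ r * (3 ^ r * v)     ∎)

-- For v = 3x + w, α = 2v + x and β = 2v − x. The ratio α/β is just below the positive root of
-- xλ² + wλ = 2x + w, and μ makes βx c(k+1) + μ c(k) grow at least by that ratio.
module Recurrence (x w : ℕ) (c : ℕ → ℕ) where

  α β μ : ℕ
  α = 7 * x + 2 * w
  β = 5 * x + 2 * w
  μ = β * w + α * x

  potential : ℕ → ℕ
  potential k = β * x * c (suc k) + μ * c k

  -- Multiplied by β², this is xλ² + wλ ≤ 2x + w at λ = α/β, which places α/β below the positive
  -- root. The two sides differ by exactly x³ + 2x²w.
  α*μ≤ : α * μ ≤ β * β * (2 * x + w)
  α*μ≤ = ≤-trans (m≤m+n _ (x * x * x + 2 * (x * x * w))) (≤-reflexive (e x w))
    where
    e : ∀ x w → (7 * x + 2 * w) * ((5 * x + 2 * w) * w + (7 * x + 2 * w) * x) + (x * x * x + 2 * (x * x * w))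
      ≡ (5 * x + 2 * w) * (5 * x + 2 * w) * (2 * x + w)
    e = solve-∀

  potential-step : ∀ k → (2 * x + w) * c k ≤ w * c (suc k) + x * c (2 + k) →
    α * potential k ≤ β * potential (suc k)
  potential-step k h = begin
    α * (β * x * c₁ + μ * c₀)                                ≡⟨ e₁ α β x μ c₀ c₁ ⟩
    α * β * x * c₁ + α * μ * c₀                              ≤⟨ +-monoʳ-≤ _ (*-monoˡ-≤ c₀ α*μ≤) ⟩
    α * β * x * c₁ + β * β * (2 * x + w) * c₀                ≡⟨ cong (α * β * x * c₁ +_) (*-assoc (β * β) (2 * x + w) c₀) ⟩
    α * β * x * c₁ + β * β * ((2 * x + w) * c₀)              ≤⟨ +-monoʳ-≤ _ (*-monoʳ-≤ (β * β) h) ⟩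
    α * β * x * c₁ + β * β * (w * c₁ + x * c₂)               ≡⟨ e₂ α β x w c₁ c₂ ⟩
    β * (β * x * c₂ + μ * c₁)                                ∎
    where
    c₀ = c k
    c₁ = c (suc k)
    c₂ = c (2 + k)
    e₁ : ∀ α β x μ p q → α * (β * x * q + μ * p) ≡ α * β * x * q + α * μ * p
    e₁ = solve-∀
    e₂ : ∀ α β x w p q → α * β * x * p + β * β * (w * p + x * q) ≡ β * (β * x * q + (β * w + α * x) * p)
    e₂ = solve-∀

  potential-growth : ∀ j → (∀ {k} → k < j → (2 * x + w) * c k ≤ w * c (suc k) + x * c (2 + k)) →
    α ^ j * potential 0 ≤ β ^ j * potential j
  potential-growth zero    h = ≤-refl
  potential-growth (suc j) h = begin
    α * α ^ j * potential 0          ≡⟨ *-assoc α (α ^ j) _ ⟩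
    α * (α ^ j * potential 0)        ≤⟨ *-monoʳ-≤ α (potential-growth j (λ k<j → h (m≤n⇒m≤1+n k<j))) ⟩
    α * (β ^ j * potential j)        ≡⟨ e α (β ^ j) (potential j) ⟩
    β ^ j * (α * potential j)        ≤⟨ *-monoʳ-≤ (β ^ j) (potential-step j (h ≤-refl)) ⟩
    β ^ j * (β * potential (suc j))  ≡⟨ e′ β (β ^ j) (potential (suc j)) ⟩
    β * β ^ j * potential (suc j)    ∎
    where
    e : ∀ a b c → a * (b * c) ≡ b * (a * c)
    e = solve-∀
    e′ : ∀ a b c → b * (a * c) ≡ a * b * c
    e′ = solve-∀

  -- The initial potential is at least βx + μ and the final one at most (βx + μ)V, so this common
  -- factor cancels.
  geometric-growth : ∀ j V .{{_ : NonZero (β * x + μ)}} →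
    (∀ {k} → k < j → (2 * x + w) * c k ≤ w * c (suc k) + x * c (2 + k)) →
    1 ≤ c 0 → 1 ≤ c 1 → c j ≤ V → c (suc j) ≤ V → α ^ j ≤ β ^ j * V
  geometric-growth j V h 1≤c₀ 1≤c₁ cⱼ≤V c₁₊ⱼ≤V = *-cancelʳ-≤ _ _ (β * x + μ) (begin
    α ^ j * (β * x + μ)             ≡⟨ cong (α ^ j *_) (cong₂ _+_ (sym (*-identityʳ (β * x))) (sym (*-identityʳ μ))) ⟩
    α ^ j * (β * x * 1 + μ * 1)     ≤⟨ *-monoʳ-≤ (α ^ j) (+-mono-≤ (*-monoʳ-≤ (β * x) 1≤c₁) (*-monoʳ-≤ μ 1≤c₀)) ⟩
    α ^ j * potential 0             ≤⟨ potential-growth j h ⟩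
    β ^ j * potential j             ≤⟨ *-monoʳ-≤ (β ^ j) (+-mono-≤ (*-monoʳ-≤ (β * x) c₁₊ⱼ≤V) (*-monoʳ-≤ μ cⱼ≤V)) ⟩
    β ^ j * (β * x * V + μ * V)     ≡⟨ e (β ^ j) (β * x) μ V ⟩
    β ^ j * V * (β * x + μ)         ∎)
    where
    e : ∀ a b c V → a * (b * V + c * V) ≡ a * V * (b + c)
    e = solve-∀

-- Counting vertices and edges

χ : Bool → ℕ
χ true  = 1
χ false = 0

χ-mono : ∀ {p q} → (p ≡ true → q ≡ true) → χ p ≤ χ q
χ-mono {true}  h rewrite h refl = ≤-refl
χ-mono {false} h = z≤n

-- Makes statements about finitely many truth values decidable. Pointwise inequalities between
-- indicators are then proved by evaluating every assignment, in the local lemmas `split`, `merge`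
-- and `bound`.
∀ᵇ? : ∀ {p} {P : Bool → Set p} → (∀ b → Dec (P b)) → Dec (∀ b → P b)
∀ᵇ? P? = map′ (λ { (t , f) true → t ; (t , f) false → f }) (λ h → h true , h false) (P? true ×-dec P? false)

private variable
  A : Set
  n : ℕ

∑ : (A → ℕ) → List A → ℕ
∑ f []       = 0
∑ f (x ∷ xs) = f x + ∑ f xs

∑-cong : ∀ {f g : A → ℕ} xs → (∀ x → f x ≡ g x) → ∑ f xs ≡ ∑ g xs
∑-cong []       h = refl
∑-cong (x ∷ xs) h = cong₂ _+_ (h x) (∑-cong xs h)

∑-mono-∈ : ∀ {f g : A → ℕ} xs → (∀ {x} → x ∈ xs → f x ≤ g x) → ∑ f xs ≤ ∑ g xs
∑-mono-∈ []       h = z≤n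
∑-mono-∈ (x ∷ xs) h = +-mono-≤ (h (here refl)) (∑-mono-∈ xs (h ∘ there))

∑-mono : ∀ {f g : A → ℕ} xs → (∀ x → f x ≤ g x) → ∑ f xs ≤ ∑ g xs
∑-mono xs h = ∑-mono-∈ xs (λ {x} _ → h x)

∑-+ : ∀ (f g : A → ℕ) xs → ∑ (λ x → f x + g x) xs ≡ ∑ f xs + ∑ g xs
∑-+ f g []       = refl
∑-+ f g (x ∷ xs) = trans (cong (f x + g x +_) (∑-+ f g xs)) (e (f x) (g x) (∑ f xs) (∑ g xs))
  where
  e : ∀ a b c d → a + b + (c + d) ≡ a + c + (b + d)
  e = solve-∀

∑-* : ∀ c (f : A → ℕ) xs → ∑ (λ x → c * f x) xs ≡ c * ∑ f xs
∑-* c f []       = sym (*-zeroʳ c)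
∑-* c f (x ∷ xs) = trans (cong (c * f x +_) (∑-* c f xs)) (sym (*-distribˡ-+ c (f x) (∑ f xs)))

∑-zero : ∀ {f : A → ℕ} xs → (∀ x → f x ≡ 0) → ∑ f xs ≡ 0
∑-zero xs h = trans (∑-cong xs h) (∑-* 0 (λ _ → 0) xs)

∑-map : ∀ {B : Set} (f : B → ℕ) (h : A → B) xs → ∑ f (map h xs) ≡ ∑ (f ∘ h) xs
∑-map f h []       = refl
∑-map f h (x ∷ xs) = cong (f (h x) +_) (∑-map f h xs)

∑-allFin-suc : (f : Fin (suc n) → ℕ) → ∑ f (allFin (suc n)) ≡ f zero + ∑ (f ∘ suc) (allFin n)
∑-allFin-suc {n} f = cong (f zero +_) (trans (cong (∑ f) (sym (map-tabulate id suc))) (∑-map f suc (allFin n)))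

∑-∈ : ∀ (f : A → ℕ) {x xs} → x ∈ xs → f x ≤ ∑ f xs
∑-∈ f (here refl)        = m≤m+n _ _
∑-∈ f (there {x = y} x∈) = ≤-trans (∑-∈ f x∈) (m≤n+m _ (f y))

∑-filterᵇ : ∀ (q : A → Bool) f xs → ∑ f (filterᵇ q xs) ≡ ∑ (λ x → χ (q x) * f x) xs
∑-filterᵇ q f []       = refl
∑-filterᵇ q f (x ∷ xs) with q x
... | true  = cong₂ _+_ (sym (*-identityˡ (f x))) (∑-filterᵇ q f xs)
... | false = ∑-filterᵇ q f xs

length-filterᵇ : ∀ (q : A → Bool) xs → length (filterᵇ q xs) ≡ ∑ (χ ∘ q) xs
length-filterᵇ q []       = refl
length-filterᵇ q (x ∷ xs) with q x
... | true  = cong suc (length-filterᵇ q xs)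
... | false = length-filterᵇ q xs

∑-const-1 : ∀ (xs : List A) → ∑ (λ _ → 1) xs ≡ length xs
∑-const-1 []       = refl
∑-const-1 (x ∷ xs) = cong suc (∑-const-1 xs)

δ : Fin n → Fin n → ℕ
δ a u = χ ⌊ a ≟ᶠ u ⌋

≟-refl : (a : Fin n) → ⌊ a ≟ᶠ a ⌋ ≡ true
≟-refl a with a ≟ᶠ a
... | yes _   = refl
... | no  a≢a = contradiction refl a≢a

δ-refl : (u : Fin n) → δ u u ≡ 1
δ-refl u = cong χ (≟-refl u)

δ-suc : (a u : Fin n) → δ (suc a) (suc u) ≡ δ a u
δ-suc a u with a ≟ᶠ u
... | yes _ = refl
... | no  _ = refl

∑-δ : (a : Fin n) (g : Fin n → ℕ) → ∑ (λ u → δ a u * g u) (allFin n) ≡ g a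
∑-δ {suc n} zero    g = trans (∑-allFin-suc (λ u → δ zero u * g u))
  (trans (cong₂ _+_ (*-identityˡ (g zero)) (∑-zero (allFin n) (λ _ → refl))) (+-identityʳ _))
∑-δ {suc n} (suc a) g = trans (∑-allFin-suc (λ u → δ (suc a) u * g u))
  (trans (∑-cong (allFin n) (λ u → cong (_* g (suc u)) (δ-suc a u))) (∑-δ a (g ∘ suc)))

VertexSet : ℕ → Set
VertexSet n = Fin n → Bool

Edges : ℕ → Set
Edges n = List (Fin n × Fin n)

infix 4 _⊑_
_⊑_ : VertexSet n → VertexSet n → Set
X ⊑ Y = ∀ {u} → X u ≡ true → Y u ≡ true

infixl 7 _⊓ˢ_ _∖_
infixl 6 _⊔ˢ_
_⊔ˢ_ _⊓ˢ_ _∖_ : VertexSet n → VertexSet n → VertexSet n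
(X ⊔ˢ Y) u = X u ∨ Y u
(X ⊓ˢ Y) u = X u ∧ Y u
(X ∖ Y) u = X u ∧ not (Y u)

size : VertexSet n → ℕ
size {n} X = ∑ (χ ∘ X) (allFin n)

inside touching : Edges n → VertexSet n → ℕ
inside   es X = ∑ (λ e → χ (X (proj₁ e) ∧ X (proj₂ e))) es
touching es X = ∑ (λ e → χ (X (proj₁ e) ∨ X (proj₂ e))) es

-- The two ends of an edge carry separate weights, so that `degree` and `degreeInto` share one
-- double count. A loop contributes at both of its ends.
weightedDegree : (g h : Fin n × Fin n → ℕ) → Edges n → Fin n → ℕ
weightedDegree g h es u = ∑ (λ e → g e * δ (proj₁ e) u + h e * δ (proj₂ e) u) es

degree : Edges n → Fin n → ℕ
degree = weightedDegree (λ _ → 1) (λ _ → 1)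

-- Each end is weighted by whether the opposite end lies in X.
degreeInto : VertexSet n → Edges n → Fin n → ℕ
degreeInto X = weightedDegree (χ ∘ X ∘ proj₂) (χ ∘ X ∘ proj₁)

-- Double counting of edge ends in X, by induction on the edge list: `∑-δ` collapses the vertex sum
-- for a single edge to its two endpoints.
handshake : (g h : Fin n × Fin n → ℕ) (es : Edges n) (X : VertexSet n) →
  ∑ (λ u → χ (X u) * weightedDegree g h es u) (allFin n) ≡
  ∑ (λ e → g e * χ (X (proj₁ e)) + h e * χ (X (proj₂ e))) es
handshake {n} g h []             X = ∑-zero (allFin n) (λ u → *-zeroʳ (χ (X u)))
handshake {n} g h (e@(a , b) ∷ es) X = trans
  (∑-cong (allFin n) (λ u → expand (χ (X u)) (g e) (h e) (δ a u) (δ b u) (weightedDegree g h es u)))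
  (trans (∑-+ _ (λ u → χ (X u) * weightedDegree g h es u) (allFin n))
    (cong₂ _+_ (trans (∑-+ _ _ (allFin n)) (cong₂ _+_ (∑-δ a (λ u → g e * χ (X u))) (∑-δ b (λ u → h e * χ (X u)))))
      (handshake g h es X)))
  where
  expand : ∀ x g h p q w → x * ((g * p + h * q) + w) ≡ (p * (g * x) + q * (h * x)) + x * w
  expand = solve-∀

-- The factors 1 are kept so that this is literally the right side of `handshake` at unit weights;
-- `crossing` is likewise its right side for `degreeInto`.
degreeSum : Edges n → VertexSet n → ℕ
degreeSum es X = ∑ (λ e → 1 * χ (X (proj₁ e)) + 1 * χ (X (proj₂ e))) es

crossing : Edges n → VertexSet n → VertexSet n → ℕ
crossing es X W = ∑ (λ e → χ (X (proj₂ e)) * χ (W (proj₁ e)) + χ (X (proj₁ e)) * χ (W (proj₂ e))) es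

size≤crossing : ∀ es (X W : VertexSet n) → (∀ {u} → W u ≡ true → 1 ≤ degreeInto X es u) → size W ≤ crossing es X W
size≤crossing {n} es X W h = begin
  size W                                                        ≤⟨ ∑-mono (allFin n) pointwise ⟩
  ∑ (λ u → χ (W u) * degreeInto X es u) (allFin n)              ≡⟨ handshake (χ ∘ X ∘ proj₂) (χ ∘ X ∘ proj₁) es W ⟩
  crossing es X W                                               ∎
  where
  pointwise : ∀ u → χ (W u) ≤ χ (W u) * degreeInto X es u
  pointwise u with W u in eq
  ... | false = z≤n
  ... | true  = ≤-trans (h eq) (≤-reflexive (sym (*-identityˡ _)))

Adjacent : Edges n → Fin n → Fin n → Set
Adjacent es z y = (z , y) ∈ es ⊎ (y , z) ∈ es

degreeInto-adjacent : ∀ {X : VertexSet n} {es : Edges n} {z y} → Adjacent es z y → X z ≡ true → 1 ≤ degreeInto X es y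
degreeInto-adjacent {X = X} {es} {z} {y} (inj₁ zy∈) Xz = begin
  1                                               ≡⟨ sym (cong₂ _*_ (cong χ Xz) (δ-refl y)) ⟩
  χ (X z) * δ y y                                 ≤⟨ m≤n+m _ (χ (X y) * δ z y) ⟩
  χ (X y) * δ z y + χ (X z) * δ y y               ≤⟨ ∑-∈ _ zy∈ ⟩
  degreeInto X es y                               ∎
degreeInto-adjacent {X = X} {es} {z} {y} (inj₂ yz∈) Xz = begin
  1                                               ≡⟨ sym (cong₂ _*_ (cong χ Xz) (δ-refl y)) ⟩
  χ (X z) * δ y y                                 ≤⟨ m≤m+n _ _ ⟩
  χ (X z) * δ y y + χ (X y) * δ z y               ≤⟨ ∑-∈ _ yz∈ ⟩
  degreeInto X es y                               ∎

∨-split : ∀ {p q} → p ∨ q ≡ true → p ≡ true ⊎ q ≡ true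
∨-split {true}  _ = inj₁ refl
∨-split {false} h = inj₂ h

∧-split : ∀ {p q} → p ∧ q ≡ true → p ≡ true × q ≡ true
∧-split {true} h = refl , h

any-∈ : ∀ (q : A → Bool) xs → any q xs ≡ true → ∃[ x ] (x ∈ xs × q x ≡ true)
any-∈ q (x ∷ xs) h with ∨-split {q x} h
... | inj₁ qx = x , here refl , qx
... | inj₂ h′ with y , y∈ , qy ← any-∈ q xs h′ = y , there y∈ , qy

∈-any : ∀ (q : A → Bool) {x xs} → x ∈ xs → q x ≡ true → any q xs ≡ true
∈-any q (here refl)      qx rewrite qx = refl
∈-any q (there {x = y} x∈) qx rewrite ∈-any q x∈ qx = ∨-zeroʳ (q y)

≟-sound : (a b : Fin n) → ⌊ a ≟ᶠ b ⌋ ≡ true → a ≡ b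
≟-sound a b h with a ≟ᶠ b
... | yes a≡b = a≡b

-- The disjunction over edges in inBall is a private function of Defs; the underscore recovers it by
-- unification in inBall-suc, where abstracting edges H makes the list argument a variable.
mutual
  edgeDisjunction : (H : MultiGraph) → Fin (nV H) → ℕ → Fin (nV H) → Edges (nV H) → Bool
  edgeDisjunction H o k y es = _

  inBall-suc : ∀ H o k y → inBall H o (suc k) y ≡ inBall H o k y ∨ edgeDisjunction H o k y (edges H)
  inBall-suc H o k y with edges H
  ... | es = refl

-- The recursive equations determine the function. This replaces the disjunction hidden in `inBall`
-- by `any`, to which `any-∈` and `∈-any` apply.
any-unique : ∀ (q : A → Bool) (g : List A → Bool) → g [] ≡ false → (∀ x xs → g (x ∷ xs) ≡ q x ∨ g xs) →
  ∀ xs → g xs ≡ any q xs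
any-unique q g g[] g∷ []       = g[]
any-unique q g g[] g∷ (x ∷ xs) = trans (g∷ x xs) (cong (q x ∨_) (any-unique q g g[] g∷ xs))

-- Balls around a root, their connectivity and their sparse subsets

module Ball (H : MultiGraph) (o : Fin (nV H)) where

  B : ℕ → VertexSet (nV H)
  B = inBall H o

  reaches : ℕ → Fin (nV H) → Fin (nV H) × Fin (nV H) → Bool
  reaches k y (a , b) = (B k a ∧ ⌊ b ≟ᶠ y ⌋) ∨ (B k b ∧ ⌊ a ≟ᶠ y ⌋)

  ball-suc : ∀ k y → B (suc k) y ≡ B k y ∨ any (reaches k y) (edges H)
  ball-suc k y = trans (inBall-suc H o k y)
    (cong (B k y ∨_) (any-unique (reaches k y) (edgeDisjunction H o k y) refl (λ _ _ → refl) (edges H)))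

  root∈ball : ∀ k → B k o ≡ true
  root∈ball zero    = ≟-refl o
  root∈ball (suc k) rewrite ball-suc k o | root∈ball k = refl

  ball-mono : ∀ k → B k ⊑ B (suc k)
  ball-mono k {u} h rewrite ball-suc k u | h = refl

  ball-mono-≤ : ∀ {k l} → k ≤ l → B k ⊑ B l
  ball-mono-≤ {k} k≤l = go (≤⇒≤′ k≤l)
    where
    go : ∀ {l} → k ≤′ l → B k ⊑ B l
    go ≤′-refl           = id
    go (≤′-step {l} k≤l) = ball-mono l ∘ go k≤l

  ball-step : ∀ k {z y} → Adjacent (edges H) z y → B k z ≡ true → B (suc k) y ≡ true
  ball-step k {z} {y} adj Bz = trans (ball-suc k y) (trans (cong (B k y ∨_) (found adj)) (∨-zeroʳ (B k y)))
    where
    found : Adjacent (edges H) z y → any (reaches k y) (edges H) ≡ true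
    found (inj₁ zy∈) = ∈-any (reaches k y) zy∈ (cong (_∨ (B k y ∧ ⌊ z ≟ᶠ y ⌋)) (cong₂ _∧_ Bz (≟-refl y)))
    found (inj₂ yz∈) = ∈-any (reaches k y) yz∈
      (trans (cong ((B k y ∧ ⌊ z ≟ᶠ y ⌋) ∨_) (cong₂ _∧_ Bz (≟-refl y))) (∨-zeroʳ _))

  ball-suc⁻ : ∀ k {y} → B (suc k) y ≡ true → B k y ≡ true ⊎ ∃[ z ] (Adjacent (edges H) z y × B k z ≡ true)
  ball-suc⁻ k {y} h with ∨-split (trans (sym (ball-suc k y)) h)
  ... | inj₁ By = inj₁ By
  ... | inj₂ q with any-∈ (reaches k y) (edges H) q
  ...   | (a , b) , ab∈ , qe with ∨-split {B k a ∧ ⌊ b ≟ᶠ y ⌋} qe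
  ...     | inj₁ p with Ba , b≟y ← ∧-split {B k a} p with refl ← ≟-sound b y b≟y = inj₂ (a , inj₁ ab∈ , Ba)
  ...     | inj₂ p with Bb , a≟y ← ∧-split {B k b} p with refl ← ≟-sound a y a≟y = inj₂ (b , inj₂ ab∈ , Bb)

  layer : ℕ → VertexSet (nV H)
  layer k = B (suc k) ∖ B k

  layer-degreeInto : ∀ k {u} → layer k u ≡ true → 1 ≤ degreeInto (B k) (edges H) u
  layer-degreeInto k {u} h with B⁺u , ¬Bu ← ∧-split {B (suc k) u} h with ball-suc⁻ k B⁺u
  ... | inj₁ Bu = contradiction (trans (sym ¬Bu) (cong not Bu)) λ ()
  ... | inj₂ (z , adj , Bz) = degreeInto-adjacent {X = B k} adj Bz

  touching≤inside-suc : ∀ k → touching (edges H) (B k) ≤ inside (edges H) (B (suc k))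
  touching≤inside-suc k = ∑-mono-∈ (edges H) pointwise
    where
    pointwise : ∀ {e} → e ∈ edges H → χ (B k (proj₁ e) ∨ B k (proj₂ e)) ≤ χ (B (suc k) (proj₁ e) ∧ B (suc k) (proj₂ e))
    pointwise {a , b} e∈ = χ-mono λ h → both (∨-split {B k a} h)
      where
      both : B k a ≡ true ⊎ B k b ≡ true → B (suc k) a ∧ B (suc k) b ≡ true
      both (inj₁ Ba) = cong₂ _∧_ (ball-mono k Ba) (ball-step k (inj₁ e∈) Ba)
      both (inj₂ Bb) = cong₂ _∧_ (ball-step k (inj₂ e∈) Bb) (ball-mono k Bb)

  -- Every vertex of W has an edge towards the root, and distinct vertices have distinct such edges.
  size≤touching-in-ball : ∀ (W : VertexSet (nV H)) → W o ≡ false → ∀ k →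
    size (W ⊓ˢ B k) ≤ ∑ (λ e → χ ((B k (proj₁ e) ∧ B k (proj₂ e)) ∧ (W (proj₁ e) ∨ W (proj₂ e)))) (edges H)
  size≤touching-in-ball W o∉W zero = ≤-trans (≤-reflexive (∑-zero (allFin (nV H)) empty)) z≤n
    where
    empty : ∀ u → χ (W u ∧ ⌊ o ≟ᶠ u ⌋) ≡ 0
    empty u with o ≟ᶠ u
    ... | yes refl rewrite o∉W = refl
    ... | no _ with W u
    ...   | true  = refl
    ...   | false = refl
  size≤touching-in-ball W o∉W (suc k) = begin
    size (W ⊓ˢ B (suc k))
      ≤⟨ ∑-mono (allFin (nV H)) (λ u → split (W u) (B k u) (B (suc k) u)) ⟩
    ∑ (λ u → χ (W u ∧ B k u) + χ (W u ∧ layer k u)) (allFin (nV H))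
      ≡⟨ ∑-+ _ _ (allFin (nV H)) ⟩
    size (W ⊓ˢ B k) + size (W ⊓ˢ layer k)
      ≤⟨ +-mono-≤ (size≤touching-in-ball W o∉W k)
           (size≤crossing (edges H) (B k) (W ⊓ˢ layer k) (λ {u} h → layer-degreeInto k (proj₂ (∧-split {W u} h)))) ⟩
    _ + crossing (edges H) (B k) (W ⊓ˢ layer k)
      ≡⟨ sym (∑-+ _ _ (edges H)) ⟩
    _
      ≤⟨ ∑-mono (edges H) (λ (a , b) → merge (B k a) (B k b) (B (suc k) a) (B (suc k) b) (W a) (W b) (ball-mono k) (ball-mono k)) ⟩
    _ ∎
    where
    split : ∀ w p q → χ (w ∧ q) ≤ χ (w ∧ p) + χ (w ∧ (q ∧ not p))
    split = toWitness {a? = ∀ᵇ? λ _ → ∀ᵇ? λ _ → ∀ᵇ? λ _ → _ ≤? _} _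
    merge : ∀ p q p⁺ q⁺ w z → (p ≡ true → p⁺ ≡ true) → (q ≡ true → q⁺ ≡ true) →
      χ ((p ∧ q) ∧ (w ∨ z)) + (χ q * χ (w ∧ (p⁺ ∧ not p)) + χ p * χ (z ∧ (q⁺ ∧ not q))) ≤ χ ((p⁺ ∧ q⁺) ∧ (w ∨ z))
    merge = toWitness {a? = ∀ᵇ? λ _ → ∀ᵇ? λ _ → ∀ᵇ? λ _ → ∀ᵇ? λ _ → ∀ᵇ? λ _ → ∀ᵇ? λ _ →
      (_ ≟ᵇ _ →-dec _ ≟ᵇ _) →-dec (_ ≟ᵇ _ →-dec _ ≟ᵇ _) →-dec _ ≤? _} _

  -- A connected graph has at least one edge fewer than vertices: `size≤touching-in-ball` is applied
  -- to all vertices except the root.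
  size≤1+inside : ∀ k → size (B k) ≤ 1 + inside (edges H) (B k)
  size≤1+inside k = begin
    size (B k)
      ≤⟨ ∑-mono (allFin (nV H)) (λ u → split ⌊ o ≟ᶠ u ⌋ (B k u)) ⟩
    ∑ (λ u → δ o u * 1 + χ (W u ∧ B k u)) (allFin (nV H))
      ≡⟨ trans (∑-+ _ _ (allFin (nV H))) (cong (_+ size (W ⊓ˢ B k)) (∑-δ o (λ _ → 1))) ⟩
    1 + size (W ⊓ˢ B k)
      ≤⟨ s≤s (size≤touching-in-ball W (cong not (≟-refl o)) k) ⟩
    1 + ∑ (λ e → χ ((B k (proj₁ e) ∧ B k (proj₂ e)) ∧ (W (proj₁ e) ∨ W (proj₂ e)))) (edges H)
      ≤⟨ s≤s (∑-mono (edges H) (λ _ → χ-mono (proj₁ ∘ ∧-split))) ⟩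
    1 + inside (edges H) (B k) ∎
    where
    W : VertexSet (nV H)
    W u = not ⌊ o ≟ᶠ u ⌋
    split : ∀ p q → χ q ≤ χ p * 1 + χ (not p ∧ q)
    split = toWitness {a? = ∀ᵇ? λ _ → ∀ᵇ? λ _ → _ ≤? _} _

  -- Deleting from the ball the vertices outside T, none of which is the root, destroys at least as
  -- many edges as vertices by `size≤touching-in-ball`. So the excess does not increase, even if T
  -- is disconnected.
  rooted-subset-sparse : ∀ {r} → inside (edges H) (B r) ≤ size (B r) →
    ∀ T → T o ≡ true → T ⊑ B r → inside (edges H) T ≤ size T
  rooted-subset-sparse {r} sparse T o∈T T⊑B = +-cancelʳ-≤ (size (W ⊓ˢ B r)) _ _ (begin
    inside (edges H) T + size (W ⊓ˢ B r)
      ≤⟨ +-monoʳ-≤ _ (size≤touching-in-ball W (cong not o∈T) r) ⟩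
    inside (edges H) T + ∑ (λ e → χ ((B r (proj₁ e) ∧ B r (proj₂ e)) ∧ (W (proj₁ e) ∨ W (proj₂ e)))) (edges H)
      ≡⟨ sym (∑-+ _ _ (edges H)) ⟩
    _
      ≤⟨ ∑-mono (edges H) (λ (a , b) → merge (T a) (T b) (B r a) (B r b) T⊑B T⊑B) ⟩
    inside (edges H) (B r)
      ≤⟨ sparse ⟩
    size (B r)
      ≤⟨ ∑-mono (allFin (nV H)) (λ u → split (T u) (B r u)) ⟩
    ∑ (λ u → χ (T u) + χ (W u ∧ B r u)) (allFin (nV H))
      ≡⟨ ∑-+ _ _ (allFin (nV H)) ⟩
    size T + size (W ⊓ˢ B r) ∎)
    where
    W : VertexSet (nV H)
    W = not ∘ T
    split : ∀ p q → χ q ≤ χ p + χ (not p ∧ q)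
    split = toWitness {a? = ∀ᵇ? λ _ → ∀ᵇ? λ _ → _ ≤? _} _
    merge : ∀ p q p⁺ q⁺ → (p ≡ true → p⁺ ≡ true) → (q ≡ true → q⁺ ≡ true) →
      χ (p ∧ q) + χ ((p⁺ ∧ q⁺) ∧ (not p ∨ not q)) ≤ χ (p⁺ ∧ q⁺)
    merge = toWitness {a? = ∀ᵇ? λ _ → ∀ᵇ? λ _ → ∀ᵇ? λ _ → ∀ᵇ? λ _ →
      (_ ≟ᵇ _ →-dec _ ≟ᵇ _) →-dec (_ ≟ᵇ _ →-dec _ ≟ᵇ _) →-dec _ ≤? _} _

-- Induced subgraphs and their balls

within : VertexSet n → Fin n × Fin n → Bool
within S e = S (proj₁ e) ∧ S (proj₂ e)

-- The vertex type is kept, so that sets and balls of H and of H[S] can be compared directly;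
-- vertices outside S merely become isolated.
restrict : (H : MultiGraph) → VertexSet (nV H) → MultiGraph
restrict H S = mkGraph (nV H) (filterᵇ (within S) (edges H))

restrict-∈ : ∀ {H S e} → e ∈ edges (restrict H S) → e ∈ edges H × within S e ≡ true
restrict-∈ {H} {S} e∈ with e∈H , Se ← ∈-filter⁻ (T? ∘ within S) {xs = edges H} e∈ = e∈H , Equivalence.to T-≡ Se

restrict-adjacent : ∀ {H S z y} → Adjacent (edges (restrict H S)) z y → Adjacent (edges H) z y × S y ≡ true
restrict-adjacent {H} {S} {z} {y} (inj₁ zy∈) with zy∈H , Se ← restrict-∈ {H} {S} zy∈ = inj₁ zy∈H , proj₂ (∧-split {S z} Se)
restrict-adjacent {H} {S} {z} {y} (inj₂ yz∈) with yz∈H , Se ← restrict-∈ {H} {S} yz∈ = inj₂ yz∈H , proj₁ (∧-split {S y} Se)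

ball-restrict⊑ball : ∀ H S o k → inBall (restrict H S) o k ⊑ inBall H o k
ball-restrict⊑ball H S o zero    h = h
ball-restrict⊑ball H S o (suc k) h with Ball.ball-suc⁻ (restrict H S) o k h
... | inj₁ By             = Ball.ball-mono H o k (ball-restrict⊑ball H S o k By)
... | inj₂ (z , adj , Bz) = Ball.ball-step H o k (proj₁ (restrict-adjacent {H} {S} adj)) (ball-restrict⊑ball H S o k Bz)

ball-restrict⊑ : ∀ H S o → S o ≡ true → ∀ k → inBall (restrict H S) o k ⊑ S
ball-restrict⊑ H S o So zero    {u} h = subst (λ w → S w ≡ true) (≟-sound o u h) So
ball-restrict⊑ H S o So (suc k)     h with Ball.ball-suc⁻ (restrict H S) o k h
... | inj₁ By            = ball-restrict⊑ H S o So k By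
... | inj₂ (_ , adj , _) = proj₂ (restrict-adjacent {H} {S} adj)

inside-restrict : ∀ H S T → inside (edges (restrict H S)) T ≤ inside (edges H) T
inside-restrict H S T = ≤-trans (≤-reflexive (∑-filterᵇ (within S) _ (edges H)))
  (∑-mono (edges H) (λ e → bound (within S e) (within T e)))
  where
  bound : ∀ p q → χ p * χ q ≤ χ q
  bound = toWitness {a? = ∀ᵇ? λ _ → ∀ᵇ? λ _ → _ ≤? _} _

BicycleFree⇒ball-sparse : ∀ H r → BicycleFreeAtRadius H r → ∀ o → inside (edges H) (inBall H o r) ≤ size (inBall H o r)
BicycleFree⇒ball-sparse H r free o = subst₂ _≤_
  (length-filterᵇ _ (edges H)) (length-filterᵇ (inBall H o r) (allFin (nV H))) (free o)

-- A ball of H[S] contains its root and lies in the radius-r ball of H, so it is a rooted subset of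
-- a sparse ball.
restrict-ball-sparse : ∀ H r S → BicycleFreeAtRadius H r → ∀ o {k} → k ≤ r →
  inside (edges (restrict H S)) (inBall (restrict H S) o k) ≤ size (inBall (restrict H S) o k)
restrict-ball-sparse H r S free o {k} k≤r = ≤-trans (inside-restrict H S (inBall (restrict H S) o k))
  (Ball.rooted-subset-sparse H o {r} (BicycleFree⇒ball-sparse H r free o) _ (Ball.root∈ball (restrict H S) o k)
    (Ball.ball-mono-≤ H o k≤r ∘ ball-restrict⊑ball H S o k))

size-∈ : (X : VertexSet n) {u : Fin n} → X u ≡ true → 1 ≤ size X
size-∈ X {u} Xu = ≤-trans (≤-reflexive (cong χ (sym Xu))) (∑-∈ (χ ∘ X) (∈-allFin u))

size≤order : (X : VertexSet n) → size X ≤ n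
size≤order {n} X = begin
  size X                       ≤⟨ ∑-mono (allFin n) (λ u → χ-mono {X u} {true} (λ _ → refl)) ⟩
  ∑ (λ _ → 1) (allFin n)       ≡⟨ trans (∑-const-1 (allFin n)) (length-tabulate id) ⟩
  n                            ∎

size-∖ : {U S : VertexSet n} → U ⊑ S → size U + size (S ∖ U) ≡ size S
size-∖ {n} {U} {S} U⊑S = trans (sym (∑-+ _ _ (allFin n))) (∑-cong (allFin n) (λ u → split (U u) (S u) U⊑S))
  where
  split : ∀ p q → (p ≡ true → q ≡ true) → χ p + χ (q ∧ not p) ≡ χ q
  split = toWitness {a? = ∀ᵇ? λ _ → ∀ᵇ? λ _ → (_ ≟ᵇ _ →-dec _ ≟ᵇ _) →-dec _ ≟ _} _

-- Existence of a critical vertex set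

Critical : (H : MultiGraph) → VertexSet (nV H) → Set
Critical H S = ∀ U → U ⊑ S → length (edges H) * size U ≤ nV H * touching (edges (restrict H S)) U

module Density (H : MultiGraph) where

  private
    E = length (edges H)
    v = nV H
    es = edges H

  Dense : VertexSet v → Set
  Dense S = E * size S ≤ v * inside es S

  Inhabited : VertexSet v → Set
  Inhabited S = ∃[ u ] (S u ≡ true)

  inhabited? : ∀ S → Dec (Inhabited S)
  inhabited? S = any? (λ u → S u ≟ᵇ true)

  ¬inhabited⇒false : ∀ {S u} → ¬ Inhabited S → S u ≡ false
  ¬inhabited⇒false {S} {u} ¬S with S u in Su
  ... | true  = contradiction (u , Su) ¬S
  ... | false = refl

  size-cong : ∀ {X Y : VertexSet v} → (∀ u → X u ≡ Y u) → size X ≡ size Y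
  size-cong h = ∑-cong (allFin v) (cong χ ∘ h)

  inside-cong : ∀ {X Y : VertexSet v} → (∀ u → X u ≡ Y u) → inside es X ≡ inside es Y
  inside-cong h = ∑-cong es (λ (a , b) → cong χ (cong₂ _∧_ (h a) (h b)))

  inside-∖ : ∀ S U → inside es (S ∖ U) + touching (edges (restrict H S)) U ≡ inside es S
  inside-∖ S U = trans (cong (inside es (S ∖ U) +_) (∑-filterᵇ (within S) _ es))
    (trans (sym (∑-+ _ _ es)) (∑-cong es (λ (a , b) → split (U a) (U b) (S a) (S b))))
    where
    split : ∀ p q s t → χ ((s ∧ not p) ∧ (t ∧ not q)) + χ (s ∧ t) * χ (p ∨ q) ≡ χ (s ∧ t)
    split = toWitness {a? = ∀ᵇ? λ _ → ∀ᵇ? λ _ → ∀ᵇ? λ _ → ∀ᵇ? λ _ → _ ≟ _} _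

  Smaller : VertexSet v → VertexSet v → Set
  Smaller S T = Inhabited T × Dense T × size T < size S

  -- Removing a nonempty U leaves T = S ∖ U, which is smaller and hence empty or not dense.
  -- Subtracting the resulting bound on T from the density of S leaves the required number of edges
  -- for U, since the edges lost are those touching U.
  minimal⇒critical : ∀ S → Dense S → (∀ T → ¬ Smaller S (lookup T)) → Critical H S
  minimal⇒critical S dense minimal U U⊑S with inhabited? U
  ... | no ¬U = ≤-trans (≤-reflexive (trans (cong (E *_) (∑-zero (allFin v) (λ u → cong χ (¬inhabited⇒false {U} {u} ¬U)))) (*-zeroʳ E))) z≤n
  ... | yes (u , Uu) = +-cancelʳ-≤ (E * size T) _ _ (begin
    E * size U + E * size T                     ≡⟨ sym (*-distribˡ-+ E (size U) (size T)) ⟩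
    E * (size U + size T)                       ≡⟨ cong (E *_) (size-∖ {U = U} {S} U⊑S) ⟩
    E * size S                                  ≤⟨ dense ⟩
    v * inside es S                             ≡⟨ cong (v *_) (sym (inside-∖ S U)) ⟩
    v * (inside es T + touching esˢ U)          ≡⟨ *-distribˡ-+ v (inside es T) (touching esˢ U) ⟩
    v * inside es T + v * touching esˢ U        ≤⟨ +-monoˡ-≤ (v * touching esˢ U) T-not-dense ⟩
    E * size T + v * touching esˢ U             ≡⟨ +-comm (E * size T) _ ⟩
    v * touching esˢ U + E * size T             ∎)
    where
    T = S ∖ U
    esˢ = edges (restrict H S)
    T≗ : ∀ w → T w ≡ lookup (tabulateᵛ T) w
    T≗ w = sym (lookup∘tabulate T w)
    T<S : size T < size S
    T<S = subst (size T <_) (size-∖ {U = U} {S} U⊑S) (+-monoˡ-≤ (size T) (size-∈ U Uu))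
    T-not-dense : v * inside es T ≤ E * size T
    T-not-dense with inhabited? T
    ... | no ¬T = ≤-trans (≤-reflexive (trans (cong (v *_)
                    (∑-zero es (λ (a , b) → cong χ (cong₂ _∧_ (¬inhabited⇒false {T} {a} ¬T) (¬inhabited⇒false {T} {b} ¬T))))) (*-zeroʳ v))) z≤n
    -- Minimality speaks of bit vectors, so T is tabulated and its size and edge count are carried
    -- across pointwise equality.
    ... | yes (w , Tw) = ≰⇒≥ λ d → minimal (tabulateᵛ T)
      ( (w , trans (sym (T≗ w)) Tw)
      , subst₂ (λ p q → E * p ≤ v * q) (size-cong T≗) (inside-cong T≗) d
      , subst (_< size S) (size-cong T≗) T<S )

  -- Descent on the size: as long as a smaller nonempty dense set exists, pass to it. Sets are bit
  -- vectors here so that `anySubset?` can search them exhaustively.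
  critical-subset : ∀ fuel (S : Subset v) → size (lookup S) < fuel → Inhabited (lookup S) → Dense (lookup S) →
    ∃[ S′ ] (Inhabited S′ × Critical H S′)
  critical-subset (suc fuel) S S<fuel inh dense
    with anySubset? (λ T → inhabited? (lookup T) ×-dec (_ ≤? _) ×-dec (size (lookup T) <? size (lookup S)))
  ... | yes (T , inhT , denseT , T<S) = critical-subset fuel T (≤-trans T<S (s≤s⁻¹ S<fuel)) inhT denseT
  ... | no minimal = lookup S , inh , minimal⇒critical (lookup S) dense (λ T s → minimal (T , s))

  -- The descent starts from the full vertex set, whose density is that of H itself.
  critical-exists : Fin v → ∃[ S ] (Inhabited S × Critical H S)
  critical-exists o = critical-subset (suc (size (lookup V))) V ≤-refl (o , V≗ o) (begin
    E * size (lookup V)    ≤⟨ *-monoʳ-≤ E (size≤order (lookup V)) ⟩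
    E * v                  ≡⟨ *-comm E v ⟩
    v * E                  ≡⟨ cong (v *_) (sym (∑-const-1 es)) ⟩
    v * ∑ (λ _ → 1) es     ≡⟨ cong (v *_) (∑-cong es (λ (a , b) → sym (cong χ (cong₂ _∧_ (V≗ a) (V≗ b))))) ⟩
    v * inside es (lookup V) ∎)
    where
    V : Subset v
    V = tabulateᵛ (λ _ → true)
    V≗ : ∀ u → lookup V u ≡ true
    V≗ = lookup∘tabulate (λ _ → true)

-- Growth of balls in a critical subgraph

module Growth (H : MultiGraph) (x : ℕ) .{{_ : NonZero x}} (excess : length (edges H) ≡ nV H + x)
  (S : VertexSet (nV H)) (critical : Critical H S) (o : Fin (nV H)) (o∈S : S o ≡ true) (r : ℕ)
  (sparse : ∀ {k} → k ≤ r → inside (edges (restrict H S)) (inBall (restrict H S) o k) ≤ size (inBall (restrict H S) o k)) where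

  open Ball (restrict H S) o

  private
    v = nV H
    es = edges (restrict H S)

  critical′ : ∀ U → U ⊑ S → (v + x) * size U ≤ v * touching es U
  critical′ U U⊑S = subst (λ E → E * size U ≤ v * touching es U) excess (critical U U⊑S)

  b : ℕ → ℕ
  b k = size (B k)

  1≤b : ∀ k → 1 ≤ b k
  1≤b k = size-∈ (B k) (root∈ball k)

  b≤v : ∀ k → b k ≤ v
  b≤v k = size≤order (B k)

  ball⊑S : ∀ k → B k ⊑ S
  ball⊑S = ball-restrict⊑ H S o o∈S

  touching≤b : ∀ {k} → k < r → touching es (B k) ≤ b (suc k)
  touching≤b {k} k<r = ≤-trans (touching≤inside-suc k) (sparse k<r)

  b-growth : ∀ {k} → k < r → (v + x) * b k ≤ v * b (suc k)
  b-growth {k} k<r = ≤-trans (critical′ (B k) (ball⊑S k)) (*-monoʳ-≤ v (touching≤b k<r))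

  b-increasing : ∀ {k} → k < r → b k < b (suc k)
  b-increasing {k} k<r = ≰⇒> λ b⁺≤b → <-irrefl refl (begin-strict
    v * b k             <⟨ *-monoˡ-< (b k) {{>-nonZero (1≤b k)}} (m<m+n v (>-nonZero⁻¹ x)) ⟩
    (v + x) * b k       ≤⟨ b-growth k<r ⟩
    v * b (suc k)       ≤⟨ *-monoʳ-≤ v b⁺≤b ⟩
    v * b k             ∎)

  -- By criticality the singleton of u is touched by at least 1 + x/v > 1 edges, and every such edge
  -- has an end at u.
  2≤degree : ∀ {u} → S u ≡ true → 2 ≤ degree es u
  2≤degree {u} Su = ≰⇒> λ deg≤1 → <-irrefl refl (begin-strict
    v                     <⟨ m<m+n v (>-nonZero⁻¹ x) ⟩
    v + x                 ≡⟨ sym (*-identityʳ (v + x)) ⟩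
    (v + x) * 1           ≤⟨ *-monoʳ-≤ (v + x) (size-∈ U (≟-refl u)) ⟩
    (v + x) * size U      ≤⟨ critical′ U (λ {w} h → subst (λ w → S w ≡ true) (sym (≟-sound w u h)) Su) ⟩
    v * touching es U     ≤⟨ *-monoʳ-≤ v (∑-mono es (λ (a , b) → bound ⌊ a ≟ᶠ u ⌋ ⌊ b ≟ᶠ u ⌋)) ⟩
    v * degree es u       ≤⟨ *-monoʳ-≤ v deg≤1 ⟩
    v * 1                 ≡⟨ *-identityʳ v ⟩
    v                     ∎)
    where
    U : VertexSet v
    U w = ⌊ w ≟ᶠ u ⌋
    bound : ∀ p q → χ (p ∨ q) ≤ 1 * χ p + 1 * χ q
    bound = toWitness {a? = ∀ᵇ? λ _ → ∀ᵇ? λ _ → _ ≤? _} _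

  -- By `2≤degree` the test selects the vertices of the next layer whose degree is exactly two.
  P : ℕ → VertexSet v
  P k u = layer k u ∧ (degree es u ≤ᵇ 2)

  p : ℕ → ℕ
  p k = size (P k)

  b-suc : ∀ k → b (suc k) ≡ b k + size (layer k)
  b-suc k = sym (size-∖ {U = B k} (ball-mono k))

  -- A vertex of `P k` has two edge ends, and at least one of them belongs to an edge into the ball,
  -- which is already counted. So it brings in at most one new edge.
  touching-⊔P : ∀ k → touching es (B k ⊔ˢ P k) ≤ touching es (B k) + p k
  touching-⊔P k = +-cancelʳ-≤ (p k) _ _ (begin
    touching es (B k ⊔ˢ P k) + p k
      ≤⟨ +-monoʳ-≤ _ (size≤crossing es (B k) (P k) (λ {u} h → layer-degreeInto k (proj₁ (∧-split {layer k u} h)))) ⟩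
    touching es (B k ⊔ˢ P k) + crossing es (B k) (P k)
      ≡⟨ sym (∑-+ _ _ es) ⟩
    _
      ≤⟨ ∑-mono es (λ (a , b) → merge (B k a) (B k b) (B (suc k) a) (B (suc k) b) (degree es a ≤ᵇ 2) (degree es b ≤ᵇ 2)) ⟩
    ∑ (λ e → χ (B k (proj₁ e) ∨ B k (proj₂ e)) + (1 * χ (P k (proj₁ e)) + 1 * χ (P k (proj₂ e)))) es
      ≡⟨ ∑-+ _ _ es ⟩
    touching es (B k) + degreeSum es (P k)
      ≤⟨ +-monoʳ-≤ _ degrees ⟩
    touching es (B k) + (p k + p k)
      ≡⟨ sym (+-assoc _ (p k) (p k)) ⟩
    touching es (B k) + p k + p k ∎)
    where
    merge : ∀ p q p⁺ q⁺ s t →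
      χ ((p ∨ ((p⁺ ∧ not p) ∧ s)) ∨ (q ∨ ((q⁺ ∧ not q) ∧ t)))
        + (χ q * χ ((p⁺ ∧ not p) ∧ s) + χ p * χ ((q⁺ ∧ not q) ∧ t))
      ≤ χ (p ∨ q) + (1 * χ ((p⁺ ∧ not p) ∧ s) + 1 * χ ((q⁺ ∧ not q) ∧ t))
    merge = toWitness {a? = ∀ᵇ? λ _ → ∀ᵇ? λ _ → ∀ᵇ? λ _ → ∀ᵇ? λ _ → ∀ᵇ? λ _ → ∀ᵇ? λ _ → _ ≤? _} _
    pointwise : ∀ u → χ (P k u) * degree es u ≤ χ (P k u) + χ (P k u)
    pointwise u with P k u in Pu
    ... | false = z≤n
    ... | true  = ≤-trans (≤-reflexive (*-identityˡ _))
                    (≤ᵇ⇒≤ (degree es u) 2 (Equivalence.from T-≡ (proj₂ (∧-split {layer k u} Pu))))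
    degrees : degreeSum es (P k) ≤ p k + p k
    degrees = begin
      degreeSum es (P k)                                  ≡⟨ sym (handshake (λ _ → 1) (λ _ → 1) es (P k)) ⟩
      ∑ (λ u → χ (P k u) * degree es u) (allFin v)        ≤⟨ ∑-mono (allFin v) pointwise ⟩
      ∑ (λ u → χ (P k u) + χ (P k u)) (allFin v)          ≡⟨ ∑-+ _ _ (allFin v) ⟩
      p k + p k                                           ∎

  size-⊔P : ∀ k → b k + p k ≡ size (B k ⊔ˢ P k)
  size-⊔P k = trans (sym (∑-+ _ _ (allFin v)))
    (∑-cong (allFin v) (λ u → split (B k u) (B (suc k) u) (degree es u ≤ᵇ 2)))
    where
    split : ∀ p q s → χ p + χ ((q ∧ not p) ∧ s) ≡ χ (p ∨ ((q ∧ not p) ∧ s))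
    split = toWitness {a? = ∀ᵇ? λ _ → ∀ᵇ? λ _ → ∀ᵇ? λ _ → _ ≟ _} _

  -- Criticality of the ball enlarged by `P k`: each added vertex demands 1 + x/v edges but supplies
  -- at most one new edge. After cancelling v p, the surplus x p remains as a gain over `b-growth`.
  b-growth⁺ : ∀ {k} → k < r → (v + x) * b k + x * p k ≤ v * b (suc k)
  b-growth⁺ {k} k<r = +-cancelʳ-≤ (v * p k) _ _ (begin
    (v + x) * b k + x * p k + v * p k      ≡⟨ e v x (b k) (p k) ⟩
    (v + x) * (b k + p k)                  ≡⟨ cong ((v + x) *_) (size-⊔P k) ⟩
    (v + x) * size (B k ⊔ˢ P k)            ≤⟨ critical′ (B k ⊔ˢ P k) (λ {u} → inS u) ⟩
    v * touching es (B k ⊔ˢ P k)           ≤⟨ *-monoʳ-≤ v (touching-⊔P k) ⟩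
    v * (touching es (B k) + p k)          ≤⟨ *-monoʳ-≤ v (+-monoˡ-≤ (p k) (touching≤b k<r)) ⟩
    v * (b (suc k) + p k)                  ≡⟨ *-distribˡ-+ v (b (suc k)) (p k) ⟩
    v * b (suc k) + v * p k                ∎)
    where
    e : ∀ v x b p → (v + x) * b + x * p + v * p ≡ (v + x) * (b + p)
    e = solve-∀
    inS : ∀ u → (B k ⊔ˢ P k) u ≡ true → S u ≡ true
    inS u h with ∨-split {B k u} h
    ... | inj₁ Bu = ball⊑S k Bu
    ... | inj₂ Pu = ball⊑S (suc k) (proj₁ (∧-split {B (suc k) u} (proj₁ (∧-split {layer k u} Pu))))

  -- Degrees in the layer are at least three outside `P k`, and a vertex of `P k` falls short by
  -- only one.
  layer-degrees : ∀ k → 3 * size (layer k) ≤ degreeSum es (layer k) + p k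
  layer-degrees k = begin
    3 * size (layer k)
      ≡⟨ sym (∑-* 3 _ (allFin v)) ⟩
    ∑ (λ u → 3 * χ (layer k u)) (allFin v)
      ≤⟨ ∑-mono (allFin v) pointwise ⟩
    ∑ (λ u → χ (layer k u) * degree es u + χ (P k u)) (allFin v)
      ≡⟨ ∑-+ _ _ (allFin v) ⟩
    ∑ (λ u → χ (layer k u) * degree es u) (allFin v) + p k
      ≡⟨ cong (_+ p k) (handshake (λ _ → 1) (λ _ → 1) es (layer k)) ⟩
    degreeSum es (layer k) + p k ∎
    where
    three : ∀ d → 2 ≤ d → 3 ≤ 1 * d + χ (d ≤ᵇ 2)
    three 1 (s≤s ())
    three 2 _ = ≤-refl
    three (suc (suc (suc d))) _ = s≤s (s≤s (s≤s z≤n))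
    pointwise : ∀ u → 3 * χ (layer k u) ≤ χ (layer k u) * degree es u + χ (P k u)
    pointwise u with layer k u in Lu
    ... | false = z≤n
    ... | true  = three (degree es u) (2≤degree (ball⊑S (suc k) (proj₁ (∧-split {B (suc k) u} Lu))))

  -- Two estimates of the degree sum of the ball of radius k + 1. From below, the inner ball
  -- contributes twice its at least b k - 1 edges, and its l layer vertices contribute l edges
  -- inwards and a degree sum of at least 3l - p. From above, the sum is touching plus inside edges,
  -- at most b (k + 2) + b (k + 1).
  b-branching : ∀ {k} → suc k < r → 3 * b (suc k) ≤ b (2 + k) + 2 + p k + 2 * b k
  b-branching {k} k<r = +-cancelʳ-≤ (b (suc k)) _ _ (begin
    3 * b (suc k) + b (suc k)
      ≡⟨ cong (λ q → 3 * q + q) (b-suc k) ⟩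
    3 * (b k + l) + (b k + l)
      ≡⟨ e₁ (b k) l ⟩
    2 * b k + (2 * b k + (l + 3 * l))
      ≤⟨ +-monoʳ-≤ (2 * b k) (+-mono-≤ (*-monoʳ-≤ 2 (size≤1+inside k))
           (+-mono-≤ (size≤crossing es (B k) (layer k) (layer-degreeInto k)) (layer-degrees k))) ⟩
    2 * b k + (2 * (1 + inside es (B k)) + (crossing es (B k) (layer k) + (degreeSum es (layer k) + p k)))
      ≡⟨ e₂ (b k) (inside es (B k)) (crossing es (B k) (layer k)) (degreeSum es (layer k)) (p k) ⟩
    (2 * inside es (B k) + (crossing es (B k) (layer k) + degreeSum es (layer k))) + (2 + p k + 2 * b k)
      ≤⟨ +-monoˡ-≤ (2 + p k + 2 * b k) edges-count ⟩
    (touching es (B (suc k)) + inside es (B (suc k))) + (2 + p k + 2 * b k)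
      ≤⟨ +-monoˡ-≤ (2 + p k + 2 * b k) (+-mono-≤ (touching≤b k<r) (sparse (<⇒≤ k<r))) ⟩
    (b (2 + k) + b (suc k)) + (2 + p k + 2 * b k)
      ≡⟨ e₃ (b k) (b (suc k)) (b (2 + k)) (p k) ⟩
    b (2 + k) + 2 + p k + 2 * b k + b (suc k) ∎)
    where
    l = size (layer k)
    e₁ : ∀ b l → 3 * (b + l) + (b + l) ≡ 2 * b + (2 * b + (l + 3 * l))
    e₁ = solve-∀
    e₂ : ∀ b i c d p → 2 * b + (2 * (1 + i) + (c + (d + p))) ≡ (2 * i + (c + d)) + (2 + p + 2 * b)
    e₂ = solve-∀
    e₃ : ∀ b b₁ b₂ p → (b₂ + b₁) + (2 + p + 2 * b) ≡ b₂ + 2 + p + 2 * b + b₁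
    e₃ = solve-∀
    merge : ∀ p q p⁺ q⁺ → (p ≡ true → p⁺ ≡ true) → (q ≡ true → q⁺ ≡ true) →
      2 * χ (p ∧ q) + ((χ q * χ (p⁺ ∧ not p) + χ p * χ (q⁺ ∧ not q)) + (1 * χ (p⁺ ∧ not p) + 1 * χ (q⁺ ∧ not q)))
      ≤ χ (p⁺ ∨ q⁺) + χ (p⁺ ∧ q⁺)
    merge = toWitness {a? = ∀ᵇ? λ _ → ∀ᵇ? λ _ → ∀ᵇ? λ _ → ∀ᵇ? λ _ →
      (_ ≟ᵇ _ →-dec _ ≟ᵇ _) →-dec (_ ≟ᵇ _ →-dec _ ≟ᵇ _) →-dec _ ≤? _} _
    -- On the right an edge is counted once for each end in the larger ball, a loop twice. On the
    -- left an edge between the ball and the layer also gets two: one from `crossing` and one from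
    -- the degree of its layer end.
    edges-count : 2 * inside es (B k) + (crossing es (B k) (layer k) + degreeSum es (layer k))
      ≤ touching es (B (suc k)) + inside es (B (suc k))
    edges-count = begin
      2 * inside es (B k) + (crossing es (B k) (layer k) + degreeSum es (layer k))
        ≡⟨ cong₂ _+_ (sym (∑-* 2 _ es)) (sym (∑-+ _ _ es)) ⟩
      _
        ≡⟨ sym (∑-+ _ _ es) ⟩
      _
        ≤⟨ ∑-mono es (λ (a , b) → merge (B k a) (B k b) (B (suc k) a) (B (suc k) b) (ball-mono k) (ball-mono k)) ⟩
      _
        ≡⟨ ∑-+ _ _ es ⟩
      touching es (B (suc k)) + inside es (B (suc k)) ∎

  -- `b-growth⁺` plus x times `b-branching`: the terms x p cancel, so the number of degree-two
  -- vertices disappears. Writing v = 3x + w keeps the coefficient v - 3x of b (k + 1) nonnegative.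
  b-recurrence : ∀ {w k} → v ≡ 3 * x + w → suc k < r →
    (2 * x + w) * b k ≤ w * b (suc k) + x * b (2 + k) + 2 * x
  b-recurrence {w} {k} v≡ k<r = +-cancelʳ-≤ (x * p k + 3 * x * b₁ + 2 * x * b₀) _ _ (begin
    (2 * x + w) * b₀ + (x * p k + 3 * x * b₁ + 2 * x * b₀)
      ≡⟨ e₁ x w b₀ b₁ (p k) ⟩
    (3 * x + w + x) * b₀ + x * p k + x * (3 * b₁)
      ≡⟨ cong (λ v → (v + x) * b₀ + x * p k + x * (3 * b₁)) (sym v≡) ⟩
    (v + x) * b₀ + x * p k + x * (3 * b₁)
      ≤⟨ +-mono-≤ (b-growth⁺ (<⇒≤ k<r)) (*-monoʳ-≤ x (b-branching k<r)) ⟩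
    v * b₁ + x * (b₂ + 2 + p k + 2 * b₀)
      ≡⟨ cong (λ v → v * b₁ + x * (b₂ + 2 + p k + 2 * b₀)) v≡ ⟩
    (3 * x + w) * b₁ + x * (b₂ + 2 + p k + 2 * b₀)
      ≡⟨ e₂ x w b₀ b₁ b₂ (p k) ⟩
    w * b₁ + x * b₂ + 2 * x + (x * p k + 3 * x * b₁ + 2 * x * b₀) ∎)
    where
    b₀ = b k
    b₁ = b (suc k)
    b₂ = b (2 + k)
    e₁ : ∀ x w b₀ b₁ p → (2 * x + w) * b₀ + (x * p + 3 * x * b₁ + 2 * x * b₀) ≡ (3 * x + w + x) * b₀ + x * p + x * (3 * b₁)
    e₁ = solve-∀
    e₂ : ∀ x w b₀ b₁ b₂ p → (3 * x + w) * b₁ + x * (b₂ + 2 + p + 2 * b₀) ≡ w * b₁ + x * b₂ + 2 * x + (x * p + 3 * x * b₁ + 2 * x * b₀)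
    e₂ = solve-∀

-- From ball growth to the excess bound

edge-endpoint : (H : MultiGraph) {m : ℕ} → length (edges H) ≡ suc m → Fin (nV H)
edge-endpoint H eq with edges H
... | (a , _) ∷ _ = a

nonZero-order : Fin n → NonZero n
nonZero-order zero    = _
nonZero-order (suc _) = _

-- Strict growth gives b 2 ≥ 3, so shifting the index by two makes the first two values of `c` at
-- least 1, as `geometric-growth` requires. Its last value `c (suc j)` is b (3 + j), hence radius 3
-- + j yields j factors.
ball-growth⇒ExpLe : ∀ (b : ℕ → ℕ) v x j w .{{_ : NonZero v}} .{{_ : NonZero x}} → v ≡ 3 * x + w →
  1 ≤ b 0 → (∀ k → b k ≤ v) → (∀ {k} → k < 3 + j → b k < b (suc k)) →
  (∀ {k} → suc k < 3 + j → (2 * x + w) * b k ≤ w * b (suc k) + x * b (2 + k) + 2 * x) →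
  ExpLe (j * x) (v ^ v)
ball-growth⇒ExpLe b v x@(suc _) j w v≡ 1≤b₀ b≤v increasing recurrence =
  ExpLe-from-growth v x β j (trans (cong (2 *_) v≡) (e₁ x w))
    (subst (λ α → α ^ j ≤ β ^ j * v) (e₂ x w)
      (geometric-growth j v c-recurrence (∸-monoˡ-≤ 2 3≤b₂) (∸-monoˡ-≤ 2 3≤b₃) (c≤v j) (c≤v (suc j))))
  where
  -- The recurrence for b has the constant solution 2, which is subtracted to make it homogeneous.
  c : ℕ → ℕ
  c k = b (2 + k) ∸ 2
  open Recurrence x w c
  e₁ : ∀ x w → 2 * (3 * x + w) ≡ (5 * x + 2 * w) + x
  e₁ = solve-∀
  e₂ : ∀ x w → 7 * x + 2 * w ≡ (5 * x + 2 * w) + 2 * x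
  e₂ = solve-∀
  c≤v : ∀ k → c k ≤ v
  c≤v k = ≤-trans (m∸n≤m (b (2 + k)) 2) (b≤v (2 + k))
  3≤b₂ : 3 ≤ b 2
  3≤b₂ = ≤-trans (s≤s (≤-trans (s≤s 1≤b₀) (increasing (s≤s z≤n)))) (increasing (s≤s (s≤s z≤n)))
  3≤b₃ : 3 ≤ b 3
  3≤b₃ = ≤-trans 3≤b₂ (<⇒≤ (increasing (s≤s (s≤s (s≤s z≤n)))))
  3≤b : ∀ k → k ≤ suc j → 3 ≤ b (2 + k)
  3≤b zero    _   = 3≤b₂
  3≤b (suc k) k<  = ≤-trans (3≤b k (<⇒≤ k<)) (<⇒≤ (increasing (s≤s (s≤s k<))))
  b≡ : ∀ {k} → k ≤ suc j → b (2 + k) ≡ 2 + c k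
  b≡ k≤ = sym (m+[n∸m]≡n (<⇒≤ (3≤b _ k≤)))
  c-recurrence : ∀ {k} → k < j → (2 * x + w) * c k ≤ w * c (suc k) + x * c (2 + k)
  c-recurrence {k} k<j = +-cancelʳ-≤ (2 * (2 * x + w)) _ _ (begin
    (2 * x + w) * c k + 2 * (2 * x + w)                       ≡⟨ e₃ (2 * x + w) (c k) ⟩
    (2 * x + w) * (2 + c k)                                   ≡⟨ cong ((2 * x + w) *_) (sym (b≡ (<⇒≤ (m≤n⇒m≤1+n k<j)))) ⟩
    (2 * x + w) * b (2 + k)                                   ≤⟨ recurrence (s≤s (s≤s (s≤s k<j))) ⟩
    w * b (3 + k) + x * b (4 + k) + 2 * x                     ≡⟨ cong₂ (λ p q → w * p + x * q + 2 * x) (b≡ (m≤n⇒m≤1+n k<j)) (b≡ (s≤s k<j)) ⟩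
    w * (2 + c (suc k)) + x * (2 + c (2 + k)) + 2 * x         ≡⟨ e₄ x w (c (suc k)) (c (2 + k)) ⟩
    w * c (suc k) + x * c (2 + k) + 2 * (2 * x + w)           ∎)
    where
    e₃ : ∀ a c → a * c + 2 * a ≡ a * (2 + c)
    e₃ = solve-∀
    e₄ : ∀ x w p q → w * (2 + p) + x * (2 + q) + 2 * x ≡ w * p + x * q + 2 * (2 * x + w)
    e₄ = solve-∀

excess-bound : ∀ H r x .{{_ : NonZero x}} → length (edges H) ≡ nV H + x → BicycleFreeAtRadius H r →
  ExpGe r (nV H ^ 10) → nV H ≤ x * r → ExpLe (x * r ∸ nV H) (nV H ^ nV H)
excess-bound H r x@(suc x′) excess free large v≤xr
  -- Positive excess forces an edge, and its endpoint shows that the vertex set is nonempty.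
  with o′ ← edge-endpoint H (trans excess (+-suc (nV H) x′))
  with S , (o , o∈S) , critical ← Density.critical-exists H o′ = go r refl 3≤r
  where
  v = nV H
  open Growth H x excess S critical o o∈S r (restrict-ball-sparse H r S free o)
  instance
    v≢0 : NonZero v
    v≢0 = nonZero-order o
    r≢0 : NonZero r
    -- If r were 0, then v ≤ x r would give v = 0, although `o` is a vertex.
    r≢0 = ≢-nonZero λ { refl → contradiction (≤-trans v≤xr (≤-reflexive (*-zeroʳ x))) (<⇒≱ (>-nonZero⁻¹ v)) }
  3x≤v : 3 * x ≤ v
  3x≤v = 3*excess≤order v x r
    -- Iterating the plain factor 1 + x/v up to radius r, where b r ≤ v, gives (1 + x/v)^r ≤ v.
    (≤-trans (power-growth b (v + x) v r (1≤b 0) b-growth r ≤-refl) (*-monoʳ-≤ (v ^ r) (b≤v r)))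
    (ExpGe⇒≤3^ large)
  3≤r : 3 ≤ r
  3≤r = *-cancelˡ-≤ x (≤-trans (≤-reflexive (*-comm x 3)) (≤-trans 3x≤v v≤xr))
  -- The split r = 3 + j goes through an equation because the growth statements above are
  -- instantiated at `r`.
  go : ∀ r′ → r ≡ r′ → 3 ≤ r′ → ExpLe (x * r ∸ v) (v ^ v)
  go (suc (suc (suc j))) refl (s≤s (s≤s (s≤s _))) n = ≤-trans (expPartial-mono n m≤jx)
    (ball-growth⇒ExpLe b v x j (v ∸ 3 * x) v≡ (1≤b 0) b≤v b-increasing (b-recurrence v≡) n)
    where
    v≡ : v ≡ 3 * x + (v ∸ 3 * x)
    v≡ = sym (m+[n∸m]≡n 3x≤v)
    e : ∀ x j → x * (3 + j) ≡ 3 * x + j * x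
    e = solve-∀
    m≤jx : x * (3 + j) ∸ v ≤ j * x
    m≤jx = m≤n+o⇒m∸n≤o (x * (3 + j)) v (≤-trans (≤-reflexive (e x j)) (+-monoˡ-≤ (j * x) 3x≤v))

-- Multiplied by r, the bound reads exc · r ≤ v + v ln v. It holds if exc · r ≤ v; otherwise, for
-- the surplus m over v, it says e^m ≤ v^v. Likewise r ≥ 10 ln v becomes v^10 ≤ e^r.
theorem2p13 : (H : MultiGraph) (r : ℕ) →
    BicycleFreeAtRadius H r →
    ExpGe r (nV H ^ 10) →
    (exc H ℤ.* ℤ.+ r ℤ.≤ ℤ.+ nV H) ⊎
    (∃[ m ] ((exc H ℤ.* ℤ.+ r ≡ ℤ.+ nV H ℤ.+ ℤ.+ m) × ExpLe m (nV H ^ nV H)))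
theorem2p13 H r free large with length (edges H) ≤? nV H
... | yes E≤v = inj₁ (ℤ.≤-trans (ℤ.*-monoʳ-≤-nonNeg (ℤ.+ r) exc≤0) (ℤ.+≤+ z≤n))
  where
  exc≤0 : exc H ℤ.≤ ℤ.0ℤ
  exc≤0 = ℤ.i≤j⇒i-j≤0 (ℤ.+≤+ E≤v)
... | no E≰v = result
  where
  v = nV H
  x = length (edges H) ∸ v
  instance
    x≢0 : NonZero x
    x≢0 = >-nonZero (m<n⇒0<n∸m (≰⇒> E≰v))
  excess : length (edges H) ≡ v + x
  excess = sym (m+[n∸m]≡n (<⇒≤ (≰⇒> E≰v)))
  exc*r : exc H ℤ.* ℤ.+ r ≡ ℤ.+ (x * r)
  exc*r = trans (cong (ℤ._* ℤ.+ r) (trans (ℤ.m-n≡m⊖n _ v) (ℤ.⊖-≥ (<⇒≤ (≰⇒> E≰v))))) (sym (ℤ.pos-* x r))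
  result : (exc H ℤ.* ℤ.+ r ℤ.≤ ℤ.+ v) ⊎ (∃[ m ] ((exc H ℤ.* ℤ.+ r ≡ ℤ.+ v ℤ.+ ℤ.+ m) × ExpLe m (v ^ v)))
  result with x * r ≤? v
  ... | yes xr≤v = inj₁ (subst (ℤ._≤ ℤ.+ v) (sym exc*r) (ℤ.+≤+ xr≤v))
  -- The surplus is m = xr - v, a truncated difference that is exact because v ≤ xr.
  ... | no xr≰v = inj₂ (x * r ∸ v , trans exc*r (cong ℤ.+_ (sym (m+[n∸m]≡n v≤xr))) , excess-bound H r x excess free large v≤xr)
    where
    v≤xr : v ≤ x * r
    v≤xr = <⇒≤ (≰⇒> xr≰v)
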